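{- Let $r$ be a positive integer and $p$ a prime. Then $p_{b(r)+1}^2\notin F_r$ and $p^3\notin F_r$.
   Context: $p_i$ denotes the $i$-th prime. For a positive integer $r$, $S_r$ is the multiplicative function with $S_r(q^\alpha)=0$ if $q\le r$ and $S_r(q^\alpha)=q^{\alpha-1}(q-r)$ if $q>r$ (for primes $q$, positive integers $\alpha$). $B_r=\{n\in\mathbb{N}: S_r(n)>0\}$, i.e. $1$ together with the positive integers whose smallest prime factor exceeds $r$. $F_r$ is the set of $n\in B_r$ such that $S_r(n)<S_r(m)$ for all $m\in B_r$ with $m>n$. $b(1)=0$, and for $r\ge 2$, $b(r)$ is the largest integer with $p_{b(r)}\le r$. -}

module Defs where

open import Data.Nat using (ℕ; zero; suc; _+_; _*_; _∸_; _^_; _≤_; _<_)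
open import Data.Nat.Primality using (Prime)
open import Data.Nat.Coprimality using (Coprime)
open import Data.Product using (_×_)
open import Relation.Binary.PropositionalEquality using (_≡_)

-- S is the multiplicative function S_r of the paper (on positive integers):
-- S(1) = 1, S(mn) = S(m) S(n) for coprime positive m n, and on prime powers
-- S(q^(a+1)) = 0 if q ≤ r, and q^a * (q - r) if q > r.
-- These properties determine S_r uniquely on positive integers.
record IsS (r : ℕ) (S : ℕ → ℕ) : Set where
  field
    S-one   : S 1 ≡ 1
    S-mult  : ∀ m n → 1 ≤ m → 1 ≤ n → Coprime m n → S (m * n) ≡ S m * S n
    S-small : ∀ q a → Prime q → q ≤ r → S (q ^ suc a) ≡ 0
    S-large : ∀ q a → Prime q → r < q → S (q ^ suc a) ≡ q ^ a * (q ∸ r)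

InB : (S : ℕ → ℕ) → ℕ → Set
InB S n = 1 ≤ n × 0 < S n

InF : (S : ℕ → ℕ) → ℕ → Set
InF S n = InB S n × (∀ m → InB S m → n < m → S n < S m)

IsLeastPrimeAbove : ℕ → ℕ → Set
IsLeastPrimeAbove r q = Prime q × r < q × (∀ q′ → Prime q′ → r < q′ → q ≤ q′)

{-# OPTIONS --safe #-}
module Submission where

{-
Everything rests on the existence, for each n ≥ 1, of two primes n < a < b ≤ 2n + 1.

Given these for n = r: the prime q′ after q = p_{b(r)+1} satisfies q′ ≤ q + r, so m = q q′ > q² has
S m = (q - r)(q′ - r) ≤ (q - r) q = S (q²).  For p³ with p > r there are two cases.  If a ≥ p, then
p < b ≤ p + r and m = p² b works in the same way.  If a < p, take a prime t with n < t ≤ 2n for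
n = ⌊p²/a⌋ and m = p a t: then a t > p², while a ≤ 2r gives (a - r)(t - r) ≤ (a/2)(2p²/a) = p².

The two primes come from Erdős' proof of Bertrand's postulate.  A prime power dividing C(2n,n) is at
most 2n, so if (n, 2n] contained at most one prime, then C(2n,n) ≤ (2n) · (2n)^√(2n) · 4^(2n/3): the
single extra prime costs only one more factor 2n, which 4ⁿ ≤ 2n C(2n,n) contradicts for large n.
-}

open import Defs
open import Data.List using ([]; _∷_)
open import Data.List.Relation.Unary.All using (_∷_)
open import Data.Bool using (if_then_else_)
open import Data.Empty using (⊥; ⊥-elim)
open import Data.Nat
open import Data.Nat.Combinatorics using (_C_; nCk≡n!/k![n-k]!; k![n∸k]!∣n!)
open import Data.Nat.Coprimality using (Coprime)
open import Data.Nat.Divisibility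
open import Data.Nat.DivMod
open import Data.Nat.Induction using (<-rec)
open import Data.Nat.ListAction using (product)
open import Data.Nat.Primality
open import Data.Nat.Primality.Factorisation using (factorise)
open import Data.Nat.Properties
open import Data.Nat.Tactic.RingSolver using (solve-∀)
open import Data.Product using (_×_; _,_; ∃; ∃₂)
open import Data.Sum using (_⊎_; inj₁; inj₂; [_,_]′)
open import Function using (_∘_; _$_)
open import Relation.Binary.Definitions using (tri<; tri≈; tri>)
open import Relation.Binary.PropositionalEquality
open import Relation.Nullary using (¬_; yes; no; does; contradiction)
open import Relation.Nullary.Decidable using (True; toWitness; decidable-stable; _×-dec_; ¬?)

-- Binomial coefficients and the common multiples of a row.

-- Indexed by the two lower parts instead of by row and position, so that no side condition k ≤ n
-- arises and both absorption rules are symmetric.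
binom : ℕ → ℕ → ℕ
binom i j = (i + j) C i

binom-! : ∀ i j → binom i j * (i ! * j !) ≡ (i + j) !
binom-! i j = begin-equality
  binom i j * (i ! * j !)
    ≡⟨ cong (λ k → binom i j * (i ! * k !)) (m+n∸m≡n i j) ⟨
  binom i j * (i ! * (i + j ∸ i) !)
    ≡⟨ cong (_* (i ! * (i + j ∸ i) !)) (nCk≡n!/k![n-k]! (m≤m+n i j)) ⟩
  ((i + j) ! / (i ! * (i + j ∸ i) !)) * (i ! * (i + j ∸ i) !)
    ≡⟨ m/n*n≡m (k![n∸k]!∣n! (m≤m+n i j)) ⟩
  (i + j) ! ∎
  where
  open ≤-Reasoning
  instance _ = i !* (i + j ∸ i) !≢0

binom-absorbʳ : ∀ i j → suc j * binom i (suc j) ≡ suc (i + j) * binom i j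
binom-absorbʳ i j = *-cancelʳ-≡ _ _ (i ! * j !) (begin-equality
  suc j * binom i (suc j) * (i ! * j !)
    ≡⟨ lem (suc j) (binom i (suc j)) (i !) (j !) ⟩
  binom i (suc j) * (i ! * suc j !)
    ≡⟨ binom-! i (suc j) ⟩
  (i + suc j) !
    ≡⟨ cong _! (+-suc i j) ⟩
  suc (i + j) * (i + j) !
    ≡⟨ cong (suc (i + j) *_) (binom-! i j) ⟨
  suc (i + j) * (binom i j * (i ! * j !))
    ≡⟨ *-assoc (suc (i + j)) (binom i j) (i ! * j !) ⟨
  suc (i + j) * binom i j * (i ! * j !) ∎)
  where
  open ≤-Reasoning
  instance _ = i !* j !≢0
  lem : ∀ a b c d → a * b * (c * d) ≡ b * (c * (a * d))
  lem = solve-∀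

binom-absorbˡ : ∀ i j → suc i * binom (suc i) j ≡ suc (i + j) * binom i j
binom-absorbˡ i j = *-cancelʳ-≡ _ _ (i ! * j !) (begin-equality
  suc i * binom (suc i) j * (i ! * j !)
    ≡⟨ lem (suc i) (binom (suc i) j) (i !) (j !) ⟩
  binom (suc i) j * (suc i ! * j !)
    ≡⟨ binom-! (suc i) j ⟩
  suc (i + j) * (i + j) !
    ≡⟨ cong (suc (i + j) *_) (binom-! i j) ⟨
  suc (i + j) * (binom i j * (i ! * j !))
    ≡⟨ *-assoc (suc (i + j)) (binom i j) (i ! * j !) ⟨
  suc (i + j) * binom i j * (i ! * j !) ∎)
  where
  open ≤-Reasoning
  instance _ = i !* j !≢0
  lem : ∀ a b c d → a * b * (c * d) ≡ b * ((a * c) * d)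
  lem = solve-∀

binom-nonZero : ∀ i j → NonZero (binom i j)
binom-nonZero i j = m*n≢0⇒m≢0 (binom i j) {{subst NonZero (sym (binom-! i j)) ((i + j) !≢0)}}

-- The reciprocals of (n + 1) C(n,k) form Leibniz' harmonic triangle: with a, b, c the multiples of
-- binom i j, binom i (suc j), binom (suc i) j, one has 1/c = 1/a - 1/b, hence D/c = D/a - D/b = u - v.
suc*binom∣common-multiple : ∀ i j D → (∀ k → 1 ≤ k → k ≤ suc (i + j) → k ∣ D) → suc (i + j) * binom i j ∣ D
suc*binom∣common-multiple zero j D h = subst (_∣ D) (sym (*-identityʳ (suc j))) (h (suc j) (s≤s z≤n) ≤-refl)
suc*binom∣common-multiple (suc i) j D h with suc*binom∣common-multiple i j D (λ k 1≤k k≤ → h k 1≤k (m≤n⇒m≤1+n k≤))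
                         | suc*binom∣common-multiple i (suc j) D (λ k 1≤k k≤ → h k 1≤k (subst (k ≤_) (cong suc (+-suc i j)) k≤))
... | divides u D≡ua | divides v D≡vb =
  ∣m+n∣m⇒∣n (subst (c ∣_) cu≡cv+D (m∣m*n u)) (m∣m*n v)
  where
  open ≤-Reasoning
  c = suc (suc i + j) * binom (suc i) j
  lem₁ : ∀ i n b u → i * (n * b * u) ≡ n * (u * (i * b))
  lem₁ = solve-∀
  lem₂ : ∀ n v j b → n * (v * (j * b)) ≡ j * (v * (n * b))
  lem₂ = solve-∀
  lem₃ : ∀ i j D → (suc j) * D + (suc i) * D ≡ suc (suc i + j) * D
  lem₃ = solve-∀
  scaled : ∀ w → suc i * (c * w) ≡ suc (suc i + j) * (w * (suc (i + j) * binom i j))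
  scaled w = trans (lem₁ (suc i) (suc (suc i + j)) (binom (suc i) j) w)
    (cong (λ x → suc (suc i + j) * (w * x)) (binom-absorbˡ i j))
  icu : suc i * (c * u) ≡ suc (suc i + j) * D
  icu = trans (scaled u) (cong (suc (suc i + j) *_) (sym D≡ua))
  icv : suc i * (c * v) ≡ suc j * D
  icv = begin-equality
    suc i * (c * v)                                           ≡⟨ scaled v ⟩
    suc (suc i + j) * (v * (suc (i + j) * binom i j))         ≡⟨ cong (λ x → suc (suc i + j) * (v * x)) (binom-absorbʳ i j) ⟨
    suc (suc i + j) * (v * (suc j * binom i (suc j)))         ≡⟨ lem₂ (suc (suc i + j)) v (suc j) (binom i (suc j)) ⟩
    suc j * (v * (suc (suc i + j) * binom i (suc j)))         ≡⟨ cong (λ x → suc j * (v * (suc x * binom i (suc j)))) (+-suc i j) ⟨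
    suc j * (v * (suc (i + suc j) * binom i (suc j)))         ≡⟨ cong (suc j *_) D≡vb ⟨
    suc j * D ∎
  cu≡cv+D : c * u ≡ c * v + D
  cu≡cv+D = *-cancelˡ-≡ (c * u) (c * v + D) (suc i) (begin-equality
    suc i * (c * u)               ≡⟨ icu ⟩
    suc (suc i + j) * D           ≡⟨ lem₃ i j D ⟨
    suc j * D + suc i * D         ≡⟨ cong (_+ suc i * D) icv ⟨
    suc i * (c * v) + suc i * D   ≡⟨ *-distribˡ-+ (suc i) (c * v) D ⟨
    suc i * (c * v + D)           ∎)

-- Prime powers dividing binomial coefficients and factorials.

prime⇒1< : ∀ {p} → Prime p → 1 < p
prime⇒1< {p} pp = nonTrivial⇒n>1 p {{prime⇒nonTrivial pp}}

prime∣prime⇒≡ : ∀ {p q} → Prime p → Prime q → p ∣ q → p ≡ q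
prime∣prime⇒≡ pp pq p∣q with prime⇒irreducible pq p∣q
... | inj₁ refl = contradiction (prime⇒1< pp) (<-irrefl refl)
... | inj₂ p≡q  = p≡q

∃-prime-divisor : ∀ n → n ≢ 0 → n ≢ 1 → ∃ λ p → Prime p × p ∣ n
∃-prime-divisor n n≢0 n≢1 with factorise n {{≢-nonZero n≢0}}
... | record { factors = []     ; isFactorisation = n≡1 } = contradiction n≡1 n≢1
... | record { factors = p ∷ ps ; isFactorisation = n≡Π ; factorsPrime = pp ∷ _ } =
  p , pp , divides (product ps) (trans n≡Π (*-comm p (product ps)))

split-prime-power : ∀ {p} → Prime p → ∀ n → n ≢ 0 → ∃₂ λ e m → n ≡ p ^ e * m × p ∤ m
split-prime-power {p} pp = <-rec _ go
  where
  go : ∀ n → (∀ {k} → k < n → k ≢ 0 → ∃₂ λ e m → k ≡ p ^ e * m × p ∤ m) →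
       n ≢ 0 → ∃₂ λ e m → n ≡ p ^ e * m × p ∤ m
  go n rec n≢0 with p ∣? n
  ... | no p∤n = 0 , n , sym (+-identityʳ n) , p∤n
  ... | yes p∣n@(divides k n≡kp) with rec (quotient-< p∣n {{prime⇒nonTrivial pp}} {{≢-nonZero n≢0}})
                                        (λ k≡0 → n≢0 (trans n≡kp (cong (_* p) k≡0)))
  ... | e , m , k≡ , p∤m = suc e , m ,
    trans n≡kp (trans (cong (_* p) k≡) (lem (p ^ e) m p)) , p∤m
    where
    lem : ∀ x m p → x * m * p ≡ p * x * m
    lem = solve-∀

^-monoʳ-∣ : ∀ p {a b} → a ≤ b → p ^ a ∣ p ^ b
^-monoʳ-∣ p {a} {b} a≤b = subst (λ c → p ^ a ∣ p ^ c) (m+[n∸m]≡n a≤b)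
  (subst (p ^ a ∣_) (sym (^-distribˡ-+-* p a (b ∸ a))) (m∣m*n (p ^ (b ∸ a))))

-- A stand-in for lcm(1, ..., N) in which only the exponent of p is controlled. The cofactor R
-- collects the p-free parts of the numbers up to N; their p-parts are at most p ^ e because N < p ^
-- (e + 1).
common-multiple : ∀ {p} → Prime p → ∀ e N → N < p ^ suc e →
  ∃ λ R → p ∤ R × (∀ k → 1 ≤ k → k ≤ N → k ∣ p ^ e * R)
common-multiple {p} pp e zero    _ = 1 , (λ p∣1 → <-irrefl (sym (∣1⇒≡1 p∣1)) (prime⇒1< pp)) ,
  λ { _ (s≤s _) () }
common-multiple {p} pp e (suc N) N<
  with common-multiple pp e N (<-trans (n<1+n N) N<) | split-prime-power pp (suc N) (λ ())
... | R , p∤R , ∣pR | a , m , N≡ , p∤m = R * m , [ p∤R , p∤m ]′ ∘ euclidsLemma R m pp , all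
  where
  a≤e : a ≤ e
  a≤e = ≮⇒≥ λ e<a → <-irrefl refl (<-≤-trans N<
    (∣⇒≤ (∣-trans (^-monoʳ-∣ p e<a) (subst (p ^ a ∣_) (sym N≡) (m∣m*n m)))))
  all : ∀ k → 1 ≤ k → k ≤ suc N → k ∣ p ^ e * (R * m)
  all k 1≤k k≤ with m≤n⇒m<n∨m≡n k≤
  ... | inj₁ (s≤s k≤N) = subst (k ∣_) (*-assoc (p ^ e) R m) (∣m⇒∣m*n m (∣pR k 1≤k k≤N))
  ... | inj₂ refl = subst (_∣ p ^ e * (R * m)) (sym N≡) (*-pres-∣ (^-monoʳ-∣ p a≤e) (n∣m*n R))

-- Let n = i + j + 1. If p ^ (e + 1) > n, some D = p ^ e * R with p ∤ R is a multiple of 1, ..., n,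
-- hence of n * `binom i j` = (j + 1) * `binom i (suc j)`. Then p ^ (e + 1) would divide D, forcing
-- p to divide R.
prime-power∣binom⇒≤ : ∀ {p} → Prime p → ∀ e i j → p ^ e ∣ binom i (suc j) → p ^ e ≤ suc (i + j)
prime-power∣binom⇒≤ pp zero i j _ = s≤s z≤n
prime-power∣binom⇒≤ {p} pp (suc e) i j p∣ = ≮⇒≥ λ lt →
  let R , p∤R , all = common-multiple pp e (suc (i + j)) lt
      D = p ^ e * R
      b∣D : binom i (suc j) ∣ D
      b∣D = ∣-trans (n∣m*n (suc j)) (subst (_∣ D) (sym (binom-absorbʳ i j)) (suc*binom∣common-multiple i j D all))
  in p∤R (*-cancelˡ-∣ (p ^ e) {{m^n≢0 p e {{prime⇒nonZero pp}}}}
       (subst (_∣ D) (*-comm p (p ^ e)) (∣-trans p∣ b∣D)))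

coprime-prime-power : ∀ {p} → Prime p → ∀ e {m n} → p ∤ m → p ^ e ∣ m * n → p ^ e ∣ n
coprime-prime-power pp zero {n = n} p∤m _ = 1∣ n
coprime-prime-power {p} pp (suc e) {m} {n} p∤m pe∣mn
  with euclidsLemma m n pp (∣-trans (m∣m*n (p ^ e)) pe∣mn)
... | inj₁ p∣m = contradiction p∣m p∤m
... | inj₂ (divides k refl) =
  subst (p ^ suc e ∣_) (*-comm p k) (*-monoʳ-∣ p
    (coprime-prime-power pp e p∤m
      (*-cancelˡ-∣ p {{prime⇒nonZero pp}} (subst (p ^ suc e ∣_) (lem m k p) pe∣mn))))
  where
  lem : ∀ m k p → m * (k * p) ≡ p * (m * k)
  lem = solve-∀

-- At most k multiples of p occur among 1, ..., m, and each is j * p with j ≤ k < p, so it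
-- contributes a single factor p.
prime-power∤! : ∀ {p} → Prime p → ∀ k → k < p → ∀ m → m < suc k * p → p ^ suc k ∤ m !
prime-power∤! {p} pp k k<p zero m< pk∣1 =
  <-irrefl (sym (∣1⇒≡1 (∣-trans (m∣m*n (p ^ k)) pk∣1))) (prime⇒1< pp)
prime-power∤! {p} pp k k<p (suc m) m< pk∣ with p ∣? suc m
... | no p∤ = prime-power∤! pp k k<p m (<-trans (n<1+n m) m<) (coprime-prime-power pp (suc k) p∤ pk∣)
... | yes (divides (suc j) m≡) = below k k<p (*-cancelʳ-< p (suc j) (suc k) (subst (_< suc k * p) m≡ m<)) pk∣
  where
  m<jp : m < suc j * p
  m<jp = subst (m <_) m≡ ≤-refl
  below : ∀ k → k < p → suc j < suc k → p ^ suc k ∣ suc m * m ! → ⊥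
  below zero k<p (s≤s ())
  below (suc k) k<p (s≤s j<) pk∣ = prime-power∤! pp k (<-trans (n<1+n k) k<p) m
    (<-≤-trans m<jp (*-monoˡ-≤ p j<))
    (coprime-prime-power pp (suc k) {suc j} (λ p∣j → <-irrefl refl (<-≤-trans (≤-<-trans j< k<p) (∣⇒≤ p∣j)))
      (*-cancelˡ-∣ p {{prime⇒nonZero pp}} (subst (p ^ suc (suc k) ∣_) (trans (cong (_* m !) m≡) (lem (suc j) p (m !))) pk∣)))
    where
    lem : ∀ j p x → j * p * x ≡ p * (j * x)
    lem = solve-∀
... | yes (divides zero ())

-- Primorials and central binomial coefficients against powers of 4.

primorial : ℕ → ℕ
primorial zero    = 1
primorial (suc n) = if does (prime? (suc n)) then suc n * primorial n else primorial n

primorial-¬prime : ∀ {n} → ¬ Prime (suc n) → primorial (suc n) ≡ primorial n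
primorial-¬prime {n} ¬pn with prime? (suc n)
... | yes pn = contradiction pn ¬pn
... | no _   = refl

-- The primes in (a, a + d] are distinct, so their product divides X. They are divided out of X from
-- the largest down; the smaller ones still divide the quotient.
primorial≤*primorial : ∀ {a X} d → X ≢ 0 →
  (∀ {p} → Prime p → a < p → p ≤ d + a → p ∣ X) → primorial (d + a) ≤ X * primorial a
primorial≤*primorial {a} {X} zero X≢0 _ = m≤n*m (primorial a) X {{≢-nonZero X≢0}}
primorial≤*primorial {a} {X} (suc d) X≢0 all with prime? (suc (d + a))
... | no _ = primorial≤*primorial d X≢0 λ pp a<p p≤ → all pp a<p (m≤n⇒m≤1+n p≤)
... | yes pn with all pn (s≤s (m≤n+m a d)) ≤-refl
... | divides k refl = begin
  n * primorial (d + a)   ≤⟨ *-monoʳ-≤ n (primorial≤*primorial d (λ k≡0 → X≢0 (cong (_* n) k≡0)) all′) ⟩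
  n * (k * primorial a)   ≡⟨ lem n k (primorial a) ⟩
  k * n * primorial a     ∎
  where
  open ≤-Reasoning
  n = suc (d + a)
  lem : ∀ n k x → n * (k * x) ≡ k * n * x
  lem = solve-∀
  all′ : ∀ {p} → Prime p → a < p → p ≤ d + a → p ∣ k
  all′ {p} pp a<p p≤ with euclidsLemma k n pp (all pp a<p (m≤n⇒m≤1+n p≤))
  ... | inj₁ p∣k = p∣k
  ... | inj₂ p∣n = contradiction (prime∣prime⇒≡ pp pn p∣n) (<⇒≢ (s≤s p≤))

prime∣!⇒≤ : ∀ {p} → Prime p → ∀ n → p ∣ n ! → p ≤ n
prime∣!⇒≤ {p} pp n p∣n! = ≮⇒≥ λ n<p → prime-power∤! pp 0 (<-trans (s≤s z≤n) (prime⇒1< pp)) n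
  (subst (n <_) (sym (+-identityʳ p)) n<p) (subst (_∣ n !) (sym (*-identityʳ p)) p∣n!)

≤⇒prime∣! : ∀ {p} → Prime p → ∀ {n} → p ≤ n → p ∣ n !
≤⇒prime∣! {zero} pp _ with prime⇒1< pp
... | ()
≤⇒prime∣! {suc p} pp p≤n = ∣-trans (m∣m*n (p !)) (m≤n⇒m!∣n! p≤n)

binom-step : ∀ m → binom (suc m) (suc m) ≡ 2 * binom m (suc m)
binom-step m = *-cancelˡ-≡ _ _ (suc m) (trans (binom-absorbˡ m (suc m))
  (lem m (binom m (suc m))))
  where
  lem : ∀ m x → suc (m + suc m) * x ≡ suc m * (2 * x)
  lem = solve-∀

-- From one odd row to the next the coefficient grows by the factor 2 (2m + 3) / (m + 2), which is
-- below 4.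
binom-odd≤4^ : ∀ m → binom m (suc m) ≤ 4 ^ m
binom-odd≤4^ zero = s≤s z≤n
binom-odd≤4^ (suc m) = *-cancelˡ-≤ (2 + m) (begin
  (2 + m) * binom (suc m) (2 + m)            ≡⟨ binom-absorbʳ (suc m) (suc m) ⟩
  suc (suc m + suc m) * binom (suc m) (suc m) ≡⟨ cong (suc (suc m + suc m) *_) (binom-step m) ⟩
  suc (suc m + suc m) * (2 * binom m (suc m)) ≤⟨ m≤n+m _ (2 * binom m (suc m)) ⟩
  2 * binom m (suc m) + suc (suc m + suc m) * (2 * binom m (suc m)) ≡⟨ lem m (binom m (suc m)) ⟩
  (2 + m) * (4 * binom m (suc m))            ≤⟨ *-monoʳ-≤ (2 + m) (*-monoʳ-≤ 4 (binom-odd≤4^ m)) ⟩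
  (2 + m) * 4 ^ suc m                        ∎)
  where
  open ≤-Reasoning
  lem : ∀ m x → 2 * x + suc (suc m + suc m) * (2 * x) ≡ (2 + m) * (4 * x)
  lem = solve-∀

-- From n to n + 1 the quantity 2n C(2n,n) is multiplied by 4 (2n + 1) / (2n), which exceeds 4.
4^≤binom : ∀ m → 4 ^ suc m ≤ 2 * suc m * binom (suc m) (suc m)
4^≤binom zero = ≤-refl
4^≤binom (suc m) = begin
  4 * 4 ^ suc m                               ≤⟨ *-monoʳ-≤ 4 (4^≤binom m) ⟩
  4 * (2 * n * binom n n)                     ≤⟨ m≤n+m _ (4 * binom n n) ⟩
  4 * binom n n + 4 * (2 * n * binom n n)     ≡⟨ lem₁ n (binom n n) ⟩
  4 * (suc (n + n) * binom n n)               ≡⟨ cong (4 *_) (binom-absorbʳ n n) ⟨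
  4 * (suc n * binom n (suc n))               ≡⟨ lem₂ (suc n) (binom n (suc n)) ⟩
  2 * suc n * (2 * binom n (suc n))           ≡⟨ cong (2 * suc n *_) (binom-step n) ⟨
  2 * suc n * binom (suc n) (suc n)           ∎
  where
  open ≤-Reasoning
  n = suc m
  lem₁ : ∀ n x → 4 * x + 4 * (2 * n * x) ≡ 4 * (suc (n + n) * x)
  lem₁ = solve-∀
  lem₂ : ∀ n x → 4 * (n * x) ≡ 2 * n * (2 * x)
  lem₂ = solve-∀

prime∣binom-odd : ∀ m {p} → Prime p → suc m < p → p ≤ m + suc m → p ∣ binom m (suc m)
prime∣binom-odd m {p} pp m<p p≤
  with euclidsLemma (binom m (suc m)) (m ! * suc m !) pp (subst (p ∣_) (sym (binom-! m (suc m))) (≤⇒prime∣! pp p≤))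
... | inj₁ p∣ = p∣
... | inj₂ p∣ with euclidsLemma (m !) (suc m !) pp p∣
... | inj₁ p∣m! = contradiction (≤-<-trans (prime∣!⇒≤ pp m p∣m!) (<-trans (n<1+n m) m<p)) (<-irrefl refl)
... | inj₂ p∣m! = contradiction (≤-<-trans (prime∣!⇒≤ pp (suc m) p∣m!) m<p) (<-irrefl refl)

even⊎odd : ∀ n → ∃ λ m → n ≡ m + m ⊎ n ≡ suc (m + m)
even⊎odd zero = 0 , inj₁ refl
even⊎odd (suc n) with even⊎odd n
... | m , inj₁ n≡ = m , inj₂ (cong suc n≡)
... | m , inj₂ n≡ = suc m , inj₁ (cong suc (trans n≡ (sym (+-suc m m))))

-- An even n > 2 is composite, so the bound for n - 1 carries over. For n = 2m + 1 the primes in (m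
-- + 1, n] all divide C(n,m) ≤ 4 ^ m, and the others contribute at most 4 ^ (m + 1) by induction.
primorial≤4^ : ∀ n → primorial n ≤ 4 ^ n
primorial≤4^ = <-rec _ go
  where
  open ≤-Reasoning
  go : ∀ n → (∀ {k} → k < n → primorial k ≤ 4 ^ k) → primorial n ≤ 4 ^ n
  go n rec with even⊎odd n
  ... | 0 , inj₁ refl = ≤-refl
  ... | 0 , inj₂ refl = s≤s z≤n
  -- n = 2, the only even prime, is checked directly.
  ... | 1 , inj₁ refl = s≤s (s≤s z≤n)
  ... | m@(suc (suc k)) , inj₁ refl = begin
    primorial (m + m)         ≡⟨ primorial-¬prime even-composite ⟩
    primorial (suc k + m)     ≤⟨ rec ≤-refl ⟩
    4 ^ (suc k + m)           ≤⟨ ^-monoʳ-≤ 4 (n≤1+n (suc k + m)) ⟩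
    4 ^ (m + m)               ∎
    where
    even-composite : ¬ Prime (m + m)
    even-composite pp = contradiction
      (prime∣prime⇒≡ prime[2] pp (divides m (lem m)))
      (<⇒≢ (s≤s (s≤s (≤-trans (s≤s z≤n) (m≤n+m m k)))))
      where
      lem : ∀ m → m + m ≡ m * 2
      lem = solve-∀
  ... | m@(suc k) , inj₂ refl = begin
    primorial (suc m + m)                 ≡⟨ cong primorial (+-comm (suc m) m) ⟩
    primorial (m + suc m)                 ≤⟨ primorial≤*primorial m (≢-nonZero⁻¹ _ {{binom-nonZero m (suc m)}}) (prime∣binom-odd m) ⟩
    binom m (suc m) * primorial (suc m)   ≤⟨ *-mono-≤ (binom-odd≤4^ m) (rec (s≤s (s≤s (m≤n+m m k)))) ⟩
    4 ^ m * 4 ^ suc m                     ≡⟨ ^-distribˡ-+-* 4 m (suc m) ⟨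
    4 ^ (m + suc m)                       ≡⟨ cong (4 ^_) (+-comm m (suc m)) ⟩
    4 ^ (suc m + m)                       ∎

-- Bounding a number through its prime powers.

Smooth : ℕ → ℕ → Set
Smooth K N = ∀ {p} → Prime p → p ∣ N → p ≤ K

smooth-drop : ∀ {K N} → Smooth (suc K) N → (Prime (suc K) → suc K ∤ N) → Smooth K N
smooth-drop sm K∤ pp p∣ with m≤n⇒m<n∨m≡n (sm pp p∣)
... | inj₁ (s≤s p≤K) = p≤K
... | inj₂ refl      = contradiction p∣ (K∤ pp)

-- The primes are split off from K downwards. A prime q ≤ s contributes at most B, and there are at
-- most K ⊓ s of these; a prime q > s divides N at most once and is paid for by its factor in
-- `primorial K`.
smooth-bound : ∀ {B s} → 1 ≤ B → ∀ K N → N ≢ 0 → Smooth K N →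
  (∀ {p} → Prime p → ∀ e → p ^ e ∣ N → p ^ e ≤ B) →
  (∀ {p} → Prime p → s < p → p ^ 2 ∤ N) →
  N ≤ B ^ (K ⊓ s) * primorial K
smooth-bound {B} {s} 1≤B zero N N≢0 sm _ _ with N ≟ 1
... | yes refl = ≤-refl
... | no N≢1 with ∃-prime-divisor N N≢0 N≢1
... | p , pp , p∣N with ≤-trans (prime⇒1< pp) (sm pp p∣N)
... | ()
smooth-bound {B} {s} 1≤B (suc K) N N≢0 sm pw sq with prime? (suc K)
... | no ¬pK = ≤-trans (smooth-bound 1≤B K N N≢0 (smooth-drop sm (λ pK → contradiction pK ¬pK)) pw sq)
  (*-monoˡ-≤ (primorial K) (^-monoʳ-≤ B {{>-nonZero 1≤B}} (⊓-monoˡ-≤ s (n≤1+n K))))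
... | yes pK with split-prime-power pK N N≢0
... | e , M , refl , K∤M = begin
  q ^ e * M                                 ≤⟨ *-monoʳ-≤ (q ^ e) ih ⟩
  q ^ e * (B ^ (K ⊓ s) * primorial K)       ≤⟨ step ⟩
  B ^ (q ⊓ s) * (q * primorial K)           ∎
  where
  open ≤-Reasoning
  q = suc K
  instance _ = >-nonZero 1≤B
  M∣N : M ∣ q ^ e * M
  M∣N = n∣m*n (q ^ e)
  ih : M ≤ B ^ (K ⊓ s) * primorial K
  ih = smooth-bound 1≤B K M (λ { refl → N≢0 (*-zeroʳ (q ^ e)) })
    (smooth-drop (λ pp p∣M → sm pp (∣-trans p∣M M∣N)) (λ _ → K∤M))
    (λ pp e′ p∣M → pw pp e′ (∣-trans p∣M M∣N))
    (λ pp s<p p∣M → sq pp s<p (∣-trans p∣M M∣N))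
  lem : ∀ b x y → b * (x * y) ≡ b * x * y
  lem = solve-∀
  lem₂ : ∀ b x y → b * (x * y) ≡ x * (b * y)
  lem₂ = solve-∀
  step : q ^ e * (B ^ (K ⊓ s) * primorial K) ≤ B ^ (q ⊓ s) * (q * primorial K)
  step with q ≤? s
  ... | yes q≤s = begin
    q ^ e * (B ^ (K ⊓ s) * primorial K)   ≤⟨ *-monoˡ-≤ _ (pw pK e (m∣m*n M)) ⟩
    B * (B ^ (K ⊓ s) * primorial K)       ≡⟨ lem B (B ^ (K ⊓ s)) (primorial K) ⟩
    B ^ suc (K ⊓ s) * primorial K         ≡⟨ cong (λ x → B ^ x * primorial K) (trans (cong suc (m≤n⇒m⊓n≡m (≤-trans (n≤1+n K) q≤s))) (sym (m≤n⇒m⊓n≡m q≤s))) ⟩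
    B ^ (q ⊓ s) * primorial K             ≤⟨ *-monoʳ-≤ (B ^ (q ⊓ s)) (m≤n*m (primorial K) q) ⟩
    B ^ (q ⊓ s) * (q * primorial K)       ∎
  ... | no q≰s = begin
    q ^ e * (B ^ (K ⊓ s) * primorial K)   ≤⟨ *-mono-≤ q^e≤q (*-monoˡ-≤ (primorial K) (^-monoʳ-≤ B (⊓-monoˡ-≤ s (n≤1+n K)))) ⟩
    q * (B ^ (q ⊓ s) * primorial K)       ≡⟨ lem₂ q (B ^ (q ⊓ s)) (primorial K) ⟩
    B ^ (q ⊓ s) * (q * primorial K)       ∎
    where
    e≤1 : e ≤ 1
    e≤1 = ≮⇒≥ λ 1<e → sq pK (≰⇒> q≰s) (∣-trans (^-monoʳ-∣ q 1<e) (m∣m*n M))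
    q^e≤q : q ^ e ≤ q
    q^e≤q = ≤-trans (^-monoʳ-≤ q e≤1) (≤-reflexive (*-identityʳ q))

-- Integer square roots and the numerical estimate for large n.

∃-sqrt : ∀ n → ∃ λ s → s * s ≤ n × n < suc s * suc s
∃-sqrt zero = 0 , z≤n , s≤s z≤n
∃-sqrt (suc n) with ∃-sqrt n
... | s , s²≤n , n< with suc n <? suc s * suc s
... | yes n<′ = s , m≤n⇒m≤1+n s²≤n , n<′
... | no n≮  = suc s , ≮⇒≥ n≮ , ≤-<-trans n< (*-mono-< {suc s} ≤-refl ≤-refl)

7*≤2^ : ∀ k → 7 * (7 + k) ≤ 2 ^ (6 + k)
7*≤2^ zero = toWitness {a? = 49 ≤? 64} _
7*≤2^ (suc k) = begin
  7 * (8 + k)                 ≤⟨ m≤m+n (7 * (8 + k)) (7 * (6 + k)) ⟩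
  7 * (8 + k) + 7 * (6 + k)   ≡⟨ lem k ⟩
  2 * (7 * (7 + k))           ≤⟨ *-monoʳ-≤ 2 (7*≤2^ k) ⟩
  2 ^ (7 + k)                 ∎
  where
  open ≤-Reasoning
  lem : ∀ k → 7 * (8 + k) + 7 * (6 + k) ≡ 2 * (7 * (7 + k))
  lem = solve-∀

-- With u = s / 7 one has s + 1 ≤ 7 (u + 1), and 7 (u + 1) ≤ 2 ^ u from u = 6 on; this is where 42 =
-- 6 * 7 comes from.
suc≤2^[/7] : ∀ {s} → 42 ≤ s → suc s ≤ 2 ^ (s / 7)
suc≤2^[/7] {s} 42≤s = begin
  suc s                                 ≡⟨ cong suc (m≡m%n+[m/n]*n s 7) ⟩
  suc (s % 7) + s / 7 * 7               ≤⟨ +-monoˡ-≤ (s / 7 * 7) (m%n<n s 7) ⟩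
  7 + s / 7 * 7                         ≡⟨ *-comm (suc (s / 7)) 7 ⟩
  7 * suc (s / 7)                       ≡⟨ cong (λ u → 7 * suc u) (m+[n∸m]≡n 6≤u) ⟨
  7 * (7 + (s / 7 ∸ 6))                 ≤⟨ 7*≤2^ (s / 7 ∸ 6) ⟩
  2 ^ (6 + (s / 7 ∸ 6))                 ≡⟨ cong (2 ^_) (m+[n∸m]≡n 6≤u) ⟩
  2 ^ (s / 7)                           ∎
  where
  open ≤-Reasoning
  6≤u : 6 ≤ s / 7
  6≤u = /-monoˡ-≤ 7 42≤s

-- With u = ⌊s/7⌋, s + 1 ≤ 2^u turns the left side into at most 2^(6u(s+2)), and 7u ≤ s.
power-bound : ∀ {s B} → 42 ≤ s → s * s ≤ B → B < suc s * suc s → B ^ (3 * (2 + s)) < 2 ^ B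
power-bound {s} {B} 42≤s s²≤B B< = begin-strict
  B ^ (3 * (2 + s))                     ≤⟨ ^-monoˡ-≤ (3 * (2 + s)) (<⇒≤ B<) ⟩
  (suc s * suc s) ^ (3 * (2 + s))       ≤⟨ ^-monoˡ-≤ (3 * (2 + s)) (*-mono-≤ (suc≤2^[/7] 42≤s) (suc≤2^[/7] 42≤s)) ⟩
  (2 ^ u * 2 ^ u) ^ (3 * (2 + s))       ≡⟨ cong (_^ (3 * (2 + s))) (^-distribˡ-+-* 2 u u) ⟨
  (2 ^ (u + u)) ^ (3 * (2 + s))         ≡⟨ ^-*-assoc 2 (u + u) (3 * (2 + s)) ⟩
  2 ^ ((u + u) * (3 * (2 + s)))         <⟨ ^-monoʳ-< 2 ≤-refl exponent< ⟩
  2 ^ (s * s)                           ≤⟨ ^-monoʳ-≤ 2 s²≤B ⟩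
  2 ^ B                                 ∎
  where
  open ≤-Reasoning
  u = s / 7
  lem₁ : ∀ u s → 7 * ((u + u) * (3 * (2 + s))) ≡ u * 7 * (6 * (2 + s))
  lem₁ = solve-∀
  lem₂ : ∀ s → 6 * (2 + s) ≡ 12 + 6 * s
  lem₂ = solve-∀
  lem₃ : ∀ s → s * (s + 6 * s) ≡ 7 * (s * s)
  lem₃ = solve-∀
  instance _ = >-nonZero (<-≤-trans (s≤s z≤n) 42≤s)
  exponent< : (u + u) * (3 * (2 + s)) < s * s
  exponent< = *-cancelˡ-< 7 _ _ (begin-strict
    7 * ((u + u) * (3 * (2 + s)))       ≡⟨ lem₁ u s ⟩
    u * 7 * (6 * (2 + s))               ≤⟨ *-monoˡ-≤ (6 * (2 + s)) (m/n*n≤m s 7) ⟩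
    s * (6 * (2 + s))                   ≡⟨ cong (s *_) (lem₂ s) ⟩
    s * (12 + 6 * s)                    <⟨ *-monoʳ-< s (+-monoˡ-< (6 * s) (<-≤-trans (toWitness {a? = 12 <? 42} _) 42≤s)) ⟩
    s * (s + 6 * s)                     ≡⟨ lem₃ s ⟩
    7 * (s * s)                         ∎)

-- Two primes above n: central binomial coefficients for large n, a chain of primes for small n.

-- Each of the two factors n ! in (2n) ! = C(2n,n) * n ! * n ! supplies one p, so p ∣ C(2n,n) would
-- give p ^ 3 ∣ (2n) !, although (2n) ! involves only the multiples p and 2p.
prime∤binom-middle : ∀ {p n} → Prime p → 2 < p → p ≤ n → n + n < 3 * p → p ∤ binom n n
prime∤binom-middle {p} {n} pp 2<p p≤n 2n<3p p∣C =
  prime-power∤! pp 2 2<p (n + n) 2n<3p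
    (subst (p ^ 3 ∣_) (binom-! n n)
      (*-pres-∣ p∣C (*-pres-∣ p∣n! (subst (_∣ n !) (sym (*-identityʳ p)) p∣n!))))
  where
  p∣n! = ≤⇒prime∣! pp p≤n

-- The a-part of C(2n,n) is split off; the cofactor N then has no
-- prime factor above 2n/3.
¬all-primes-between≡ : ∀ {n a} → 882 ≤ n → Prime a →
  ¬ (∀ {p} → Prime p → n < p → p ≤ n + n → p ≡ a)
¬all-primes-between≡ {n@(suc k)} {a} 882≤n pa only
  with ∃-sqrt (n + n) | split-prime-power pa (binom n n) (≢-nonZero⁻¹ _ {{binom-nonZero n n}})
... | s , s²≤B , B< | e , N , C≡ , a∤N = <-irrefl refl (<-≤-trans (power-bound 42≤s s²≤B B<) 2^B≤)
  where
  open ≤-Reasoning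
  B = n + n
  M = B / 3
  -- 1764 = 42 * 42: the threshold 882 on n is chosen to make 42 ≤ s, as `power-bound` requires.
  1764≤B : 1764 ≤ B
  1764≤B = +-mono-≤ 882≤n 882≤n
  42≤s : 42 ≤ s
  42≤s = ≮⇒≥ λ s<42 → <-irrefl refl (<-≤-trans B< (≤-trans (*-mono-≤ s<42 s<42) 1764≤B))
  2≤M : 2 ≤ M
  2≤M = ≤-trans (toWitness {a? = 2 ≤? 588} _) (/-monoˡ-≤ 3 1764≤B)
  2≤n : 2 ≤ n
  2≤n = ≤-trans (toWitness {a? = 2 ≤? 882} _) 882≤n
  B<3*p : ∀ {p} → M < p → B < 3 * p
  B<3*p {p} M<p = begin-strict
    B                 ≡⟨ m≡m%n+[m/n]*n B 3 ⟩
    B % 3 + M * 3     <⟨ +-monoˡ-< (M * 3) (m%n<n B 3) ⟩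
    suc M * 3         ≤⟨ *-monoˡ-≤ 3 M<p ⟩
    p * 3             ≡⟨ *-comm p 3 ⟩
    3 * p             ∎
  prime-power≤B : ∀ {p} → Prime p → ∀ e → p ^ e ∣ binom n n → p ^ e ≤ B
  prime-power≤B {p} pp e p∣ = subst (p ^ e ≤_) (sym (+-suc n k)) (prime-power∣binom⇒≤ pp e n k p∣)
  N∣C : N ∣ binom n n
  N∣C = subst (N ∣_) (sym C≡) (n∣m*n (a ^ e))
  smooth : Smooth M N
  smooth {p} pp p∣N = ≮⇒≥ λ M<p → prime∤binom-middle pp (≤-<-trans 2≤M M<p) p≤n (B<3*p M<p) p∣C
    where
    p∣C = ∣-trans p∣N N∣C
    p≤B : p ≤ B
    p≤B = subst (_≤ B) (*-identityʳ p) (prime-power≤B pp 1 (subst (_∣ binom n n) (sym (*-identityʳ p)) p∣C))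
    p≤n : p ≤ n
    p≤n = ≮⇒≥ λ n<p → a∤N (subst (_∣ N) (only pp n<p p≤B) p∣N)
  N≢0 : N ≢ 0
  N≢0 N≡0 = ≢-nonZero⁻¹ _ {{binom-nonZero n n}} (trans C≡ (trans (cong (a ^ e *_) N≡0) (*-zeroʳ (a ^ e))))
  N≤ : N ≤ B ^ s * 4 ^ M
  N≤ = begin
    N                               ≤⟨ smooth-bound {B} {s} (s≤s z≤n) M N N≢0 smooth
                                         (λ pp e p∣N → prime-power≤B pp e (∣-trans p∣N N∣C))
                                         -- For p > s already p ^ 2 ≥ (s + 1) ^ 2 > B, too large for
                                         -- a prime power dividing C(2n,n).
                                         (λ {p} pp s<p p²∣N → <-irrefl refl (<-≤-trans B<
                                            (≤-trans (*-mono-≤ s<p s<p) (subst (_≤ B) (cong (p *_) (*-identityʳ p))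
                                              (prime-power≤B pp 2 (∣-trans p²∣N N∣C)))))) ⟩
    B ^ (M ⊓ s) * primorial M       ≤⟨ *-mono-≤ (^-monoʳ-≤ B (m⊓n≤n M s)) (primorial≤4^ M) ⟩
    B ^ s * 4 ^ M                   ∎
  -- Of the exponent 2 + s, one B is the factor 2n of the lower bound for C(2n,n), one bounds the
  -- a-part, and s come from the primes up to s.
  4^n≤ : 4 ^ n ≤ B ^ (2 + s) * 4 ^ M
  4^n≤ = begin
    4 ^ n                           ≤⟨ 4^≤binom k ⟩
    2 * n * binom n n               ≡⟨ cong₂ _*_ (cong (n +_) (+-identityʳ n)) C≡ ⟩
    B * (a ^ e * N)                 ≤⟨ *-monoʳ-≤ B (*-mono-≤ (prime-power≤B pa e (subst (a ^ e ∣_) (sym C≡) (m∣m*n N))) N≤) ⟩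
    B * (B * (B ^ s * 4 ^ M))       ≡⟨ lem B (B ^ s) (4 ^ M) ⟩
    B ^ (2 + s) * 4 ^ M             ∎
    where
    lem : ∀ b x y → b * (b * (x * y)) ≡ b * (b * x) * y
    lem = solve-∀
  *-^3 : ∀ x y → x * y * (x * y * (x * y * 1)) ≡ x * (x * (x * 1)) * (y * (y * (y * 1)))
  *-^3 = solve-∀
  4^≡2^ : ∀ m → 4 ^ m ≡ 2 ^ (m + m)
  4^≡2^ m = trans (^-*-assoc 2 2 m) (cong (2 ^_) (cong (m +_) (+-identityʳ m)))
  -- Cubing removes the division in M = B / 3: the left side becomes 2 ^ B * 4 ^ B, and 4 ^ (M * 3)
  -- ≤ 4 ^ B cancels.
  2^B≤ : 2 ^ B ≤ B ^ (3 * (2 + s))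
  2^B≤ = *-cancelʳ-≤ _ _ (4 ^ B) {{m^n≢0 4 B}} (begin
    2 ^ B * 4 ^ B                         ≡⟨ cong₂ _*_ (sym (4^≡2^ n)) (^-distribˡ-+-* 4 n n) ⟩
    4 ^ n * (4 ^ n * 4 ^ n)               ≡⟨ lem (4 ^ n) ⟩
    (4 ^ n) ^ 3                           ≤⟨ ^-monoˡ-≤ 3 4^n≤ ⟩
    (B ^ (2 + s) * 4 ^ M) ^ 3             ≡⟨ *-^3 (B ^ (2 + s)) (4 ^ M) ⟩
    (B ^ (2 + s)) ^ 3 * (4 ^ M) ^ 3       ≡⟨ cong₂ _*_ (^-*-assoc B (2 + s) 3) (^-*-assoc 4 M 3) ⟩
    B ^ ((2 + s) * 3) * 4 ^ (M * 3)       ≤⟨ *-mono-≤ (≤-reflexive (cong (B ^_) (*-comm (2 + s) 3))) (^-monoʳ-≤ 4 (m/n*n≤m B 3)) ⟩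
    B ^ (3 * (2 + s)) * 4 ^ B             ∎)
    where
    lem : ∀ x → x * (x * x) ≡ x * (x * (x * 1))
    lem = solve-∀

-- The bound is 2n + 1 rather than 2n so that small n need no exceptions: (n, 2n] holds fewer than two
-- primes for n = 1, 2, 3, 5.
TwoPrimesAbove : ℕ → Set
TwoPrimesAbove n = ∃₂ λ a b → Prime a × Prime b × n < a × a < b × b ≤ suc (n + n)

-- The search below 2n + 1 is decidable, so refuting that every prime there equals a produces an
-- actual prime.
another-prime : ∀ {n a} → 882 ≤ n → Prime a → ∃ λ p → Prime p × n < p × p ≤ n + n × p ≢ a
another-prime {n} {a} 882≤n pa
  with anyUpTo? (λ p → prime? p ×-dec n <? p ×-dec ¬? (p ≟ a)) (suc (n + n))
... | yes (p , s≤s p≤ , pp , n<p , p≢a) = p , pp , n<p , p≤ , p≢a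
... | no none = ⊥-elim (¬all-primes-between≡ 882≤n pa λ {p} pp n<p p≤ →
  decidable-stable (p ≟ a) λ p≢a → none (p , s≤s p≤ , pp , n<p , p≢a))

twoPrimes-large : ∀ {n} → 882 ≤ n → TwoPrimesAbove n
-- Excluding 2, which is not above n anyway, gives a first prime; excluding that one gives a second.
twoPrimes-large 882≤n with another-prime 882≤n prime[2]
... | a , pa , n<a , a≤ , _ with another-prime 882≤n pa
... | b , pb , n<b , b≤ , b≢a with <-cmp a b
... | tri< a<b _ _ = a , b , pa , pb , n<a , a<b , m≤n⇒m≤1+n b≤
... | tri≈ _ a≡b _ = contradiction (sym a≡b) b≢a
... | tri> _ _ b<a = b , a , pb , pa , n<b , b<a , m≤n⇒m≤1+n a≤

TwoPrimesOn : ℕ → ℕ → Set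
TwoPrimesOn l u = ∀ {n} → l ≤ n → n < u → TwoPrimesAbove n

-- For a ≤ n < b the primes b and c serve as long as c ≤ 2a + 1.
extend : ∀ a b c {u} {_ : True (prime? b)} {_ : True (prime? c)} {_ : True (b <? c)} {_ : True (c ≤? suc (a + a))} →
  TwoPrimesOn b u → TwoPrimesOn a u
extend a b c {_} {pb} {pc} {b<c} {c≤} above {n} a≤n n<u with n <? b
... | yes n<b = b , c , toWitness pb , toWitness pc , n<b , toWitness b<c ,
  ≤-trans (toWitness c≤) (s≤s (+-mono-≤ a≤n a≤n))
... | no n≮b = above (≮⇒≥ n≮b) n<u

-- Consecutive triples of one sequence 1, 2, 3, 5, 7, 11, 13, 19, ..., 1439, whose terms are each at
-- most one more than twice the term two places before. At 1093 the remaining range is empty.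
twoPrimes-small : TwoPrimesOn 1 1093
twoPrimes-small =
  extend 1 2 3 $ extend 2 3 5 $ extend 3 5 7 $ extend 5 7 11 $ extend 7 11 13 $
  extend 11 13 19 $ extend 13 19 23 $ extend 19 23 37 $ extend 23 37 47 $ extend 37 47 73 $
  extend 47 73 89 $ extend 73 89 139 $ extend 89 139 179 $ extend 139 179 277 $
  extend 179 277 359 $ extend 277 359 547 $ extend 359 547 719 $ extend 547 719 1093 $
  extend 719 1093 1439 $ λ 1093≤n n<1093 → contradiction (<-≤-trans n<1093 1093≤n) (<-irrefl refl)

twoPrimes : ∀ {n} → 1 ≤ n → TwoPrimesAbove n
twoPrimes {n} 1≤n with n <? 1093
... | yes n<1093 = twoPrimes-small 1≤n n<1093
... | no n≮1093 = twoPrimes-large (≤-trans (toWitness {a? = 882 ≤? 1093} _) (≮⇒≥ n≮1093))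

-- Values of `S` and numbers outside F.

prime∤⇒coprime : ∀ {m q} → Prime q → q ∤ m → Coprime m q
prime∤⇒coprime pq q∤m (d∣m , d∣q) with prime⇒irreducible pq d∣q
... | inj₁ d≡1  = d≡1
... | inj₂ refl = contradiction d∣m q∤m

module _ {r S} (isS : IsS r S) where
  open IsS isS

  S-prime : ∀ {p} → Prime p → r < p → S p ≡ p ∸ r
  S-prime {p} pp r<p = trans (cong S (sym (*-identityʳ p))) (trans (S-large p 0 pp r<p) (+-identityʳ (p ∸ r)))

  S-*-prime : ∀ {m q} → 1 ≤ m → Prime q → r < q → q ∤ m → S (m * q) ≡ S m * (q ∸ r)
  S-*-prime {m} {q} 1≤m pq r<q q∤m = trans
    (S-mult m q 1≤m (≤-trans (s≤s z≤n) r<q) (prime∤⇒coprime pq q∤m))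
    (cong (S m *_) (S-prime pq r<q))

  ∉F : ∀ {n} m → n < m → 0 < S m → S m ≤ S n → ¬ InF S n
  ∉F m n<m 0<Sm Sm≤Sn (_ , minimal) =
    <-irrefl refl (<-≤-trans (minimal m (≤-trans (s≤s z≤n) n<m , 0<Sm) n<m) Sm≤Sn)

  square∉F : ∀ {q q′} → Prime q → Prime q′ → r < q → q < q′ → q′ ≤ q + r → ¬ InF S (q ^ 2)
  square∉F {q} {q′} pq pq′ r<q q<q′ q′≤ = ∉F (q * q′) q²<qq′
    (subst (0 <_) (sym Sqq′) (*-mono-< (m<n⇒0<n∸m r<q) (m<n⇒0<n∸m r<q′))) (begin
      S (q * q′)              ≡⟨ Sqq′ ⟩
      (q ∸ r) * (q′ ∸ r)      ≤⟨ *-monoʳ-≤ (q ∸ r) (m≤n+o⇒m∸n≤o q′ r (subst (q′ ≤_) (+-comm q r) q′≤)) ⟩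
      (q ∸ r) * q             ≡⟨ lem (q ∸ r) q ⟩
      q ^ 1 * (q ∸ r)         ≡⟨ S-large q 1 pq r<q ⟨
      S (q ^ 2)               ∎)
    where
    open ≤-Reasoning
    instance _ = prime⇒nonZero pq
    r<q′ = <-trans r<q q<q′
    lem : ∀ x q → x * q ≡ q * 1 * x
    lem = solve-∀
    q²<qq′ : q ^ 2 < q * q′
    q²<qq′ = *-monoʳ-< q (subst (_< q′) (sym (*-identityʳ q)) q<q′)
    Sqq′ : S (q * q′) ≡ (q ∸ r) * (q′ ∸ r)
    Sqq′ = trans (S-*-prime (>-nonZero⁻¹ q) pq′ r<q′ (λ q′∣q → <⇒≢ q<q′ (sym (prime∣prime⇒≡ pq′ pq q′∣q))))
      (cong (_* (q′ ∸ r)) (S-prime pq r<q))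

  -- Exchanging one factor p of p ^ 3 for q replaces a factor p of S (p ^ 3) by q - r ≤ p.
  cube∉F-small : ∀ {p q} → Prime p → Prime q → r < p → p < q → q ≤ p + r → ¬ InF S (p ^ 3)
  cube∉F-small {p} {q} pp pq r<p p<q q≤ = ∉F (p ^ 2 * q) p³<p²q
    (subst (0 <_) (sym Sp²q) (*-mono-< (*-mono-< (m^n>0 p 1) (m<n⇒0<n∸m r<p)) (m<n⇒0<n∸m r<q))) (begin
      S (p ^ 2 * q)               ≡⟨ Sp²q ⟩
      p ^ 1 * (p ∸ r) * (q ∸ r)   ≤⟨ *-monoʳ-≤ (p ^ 1 * (p ∸ r)) (m≤n+o⇒m∸n≤o q r (subst (q ≤_) (+-comm p r) q≤)) ⟩
      p ^ 1 * (p ∸ r) * p         ≡⟨ lem p (p ∸ r) ⟩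
      p ^ 2 * (p ∸ r)             ≡⟨ S-large p 2 pp r<p ⟨
      S (p ^ 3)                   ∎)
    where
    open ≤-Reasoning
    instance _ = prime⇒nonZero pp
    instance _ = m^n≢0 p 2
    r<q = <-trans r<p p<q
    lem : ∀ p x → p * 1 * x * p ≡ p * (p * 1) * x
    lem = solve-∀
    p³<p²q : p ^ 3 < p ^ 2 * q
    p³<p²q = subst (_< p ^ 2 * q) (*-comm (p ^ 2) p) (*-monoʳ-< (p ^ 2) p<q)
    q∤p² : q ∤ p ^ 2
    q∤p² q∣p² with euclidsLemma p (p ^ 1) pq q∣p²
    ... | inj₁ q∣p = <⇒≢ p<q (sym (prime∣prime⇒≡ pq pp q∣p))
    ... | inj₂ q∣p = <⇒≢ p<q (sym (prime∣prime⇒≡ pq pp (subst (q ∣_) (*-identityʳ p) q∣p)))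
    Sp²q : S (p ^ 2 * q) ≡ p ^ 1 * (p ∸ r) * (q ∸ r)
    Sp²q = trans (S-*-prime (m^n>0 p 2) pq r<q q∤p²) (cong (_* (q ∸ r)) (S-large p 1 pp r<p))

  cube∉F-large : ∀ {p q} → Prime p → Prime q → r < q → q ≤ r + r → q < p → ¬ InF S (p ^ 3)
  cube∉F-large {p} {q} pp pq r<q q≤2r q<p
    with twoPrimes {(p * p / q) {{prime⇒nonZero pq}}}
           (m≥n⇒m/n>0 {{prime⇒nonZero pq}} (≤-trans (<⇒≤ q<p) (m≤m*n p p {{prime⇒nonZero pp}})))
  ... | t , t′ , pt , _ , n<t , t<t′ , t′≤ = ∉F (p * q * t) p³<pqt
    (subst (0 <_) (sym Spqt) (*-mono-< (*-mono-< (m<n⇒0<n∸m r<p) (m<n⇒0<n∸m r<q)) (m<n⇒0<n∸m r<t))) (begin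
      S (p * q * t)                       ≡⟨ Spqt ⟩
      (p ∸ r) * (q ∸ r) * (t ∸ r)         ≡⟨ *-assoc (p ∸ r) (q ∸ r) (t ∸ r) ⟩
      (p ∸ r) * ((q ∸ r) * (t ∸ r))       ≤⟨ *-monoʳ-≤ (p ∸ r) [q-r][t-r]≤p² ⟩
      (p ∸ r) * (p * p)                   ≡⟨ lem₂ (p ∸ r) p ⟩
      p ^ 2 * (p ∸ r)                     ≡⟨ S-large p 2 pp r<p ⟨
      S (p ^ 3)                           ∎)
    where
    open ≤-Reasoning
    instance _ = prime⇒nonZero pq
    instance _ = prime⇒nonZero pp
    n = p * p / q
    t≤2n : t ≤ n + n
    -- Taking the smaller of the two primes sharpens 2n + 1 to 2n.
    t≤2n = ≤-pred (≤-trans t<t′ t′≤)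
    p²<tq : p * p < t * q
    p²<tq = begin-strict
      p * p                       ≡⟨ m≡m%n+[m/n]*n (p * p) q ⟩
      (p * p) % q + n * q         <⟨ +-monoˡ-< (n * q) (m%n<n (p * p) q) ⟩
      suc n * q                   ≤⟨ *-monoˡ-≤ q n<t ⟩
      t * q                       ∎
    p<t : p < t
    -- p * q ≤ p * p < t * q; so t differs from both p and q, and S splits over the three primes.
    p<t = *-cancelʳ-< q p t (≤-<-trans (*-monoʳ-≤ p (<⇒≤ q<p)) p²<tq)
    r<p = <-trans r<q q<p
    r<t = <-trans r<p p<t
    lem₁ : ∀ p q t → p * (t * q) ≡ p * q * t
    lem₁ = solve-∀
    lem₂ : ∀ x p → x * (p * p) ≡ p * (p * 1) * x
    lem₂ = solve-∀
    lem₃ : ∀ x t → 2 * (x * t) ≡ (x + x) * t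
    lem₃ = solve-∀
    lem₄ : ∀ q n → q * (n + n) ≡ 2 * (n * q)
    lem₄ = solve-∀
    p³<pqt : p ^ 3 < p * q * t
    p³<pqt = subst (p ^ 3 <_) (lem₁ p q t) (*-monoʳ-< p (subst (_< t * q) (cong (p *_) (sym (*-identityʳ p))) p²<tq))
    q-r+q-r≤q : (q ∸ r) + (q ∸ r) ≤ q
    q-r+q-r≤q = begin
      (q ∸ r) + (q ∸ r)   ≤⟨ +-monoʳ-≤ (q ∸ r) (m≤n+o⇒m∸n≤o q r q≤2r) ⟩
      (q ∸ r) + r         ≡⟨ m∸n+n≡m (<⇒≤ r<q) ⟩
      q                   ∎
    [q-r][t-r]≤p² : (q ∸ r) * (t ∸ r) ≤ p * p
    -- Doubled to avoid halves: 2 (q - r) ≤ q since q ≤ 2r, t - r ≤ 2n, and n * q ≤ p * p.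
    [q-r][t-r]≤p² = *-cancelˡ-≤ 2 (begin
      2 * ((q ∸ r) * (t ∸ r))             ≡⟨ lem₃ (q ∸ r) (t ∸ r) ⟩
      ((q ∸ r) + (q ∸ r)) * (t ∸ r)       ≤⟨ *-mono-≤ q-r+q-r≤q (≤-trans (m∸n≤m t r) t≤2n) ⟩
      q * (n + n)                         ≡⟨ lem₄ q n ⟩
      2 * (n * q)                         ≤⟨ *-monoʳ-≤ 2 (m/n*n≤m (p * p) q) ⟩
      2 * (p * p)                         ∎)
    t∤pq : t ∤ p * q
    t∤pq t∣pq with euclidsLemma p q pt t∣pq
    ... | inj₁ t∣p = <⇒≢ p<t (sym (prime∣prime⇒≡ pt pp t∣p))
    ... | inj₂ t∣q = <⇒≢ (<-trans q<p p<t) (sym (prime∣prime⇒≡ pt pq t∣q))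
    Spqt : S (p * q * t) ≡ (p ∸ r) * (q ∸ r) * (t ∸ r)
    Spqt = trans (S-*-prime (*-mono-≤ (>-nonZero⁻¹ p) (>-nonZero⁻¹ q)) pt r<t t∤pq)
      (cong (_* (t ∸ r)) (trans
        (S-*-prime (>-nonZero⁻¹ p) pq r<q (λ q∣p → <⇒≢ q<p (prime∣prime⇒≡ pq pp q∣p)))
        (cong (_* (q ∸ r)) (S-prime pp r<p))))

  cube∉F : 1 ≤ r → ∀ p → Prime p → ¬ InF S (p ^ 3)
  cube∉F 1≤r p pp inF@((_ , 0<S) , _) with r <? p
  -- For p ≤ r the cube is not even in B.
  ... | no r≮p = contradiction (S-small p 2 pp (≮⇒≥ r≮p)) (λ S≡0 → <⇒≢ 0<S (sym S≡0))
  ... | yes r<p with twoPrimes 1≤r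
  ... | a , b , pa , pb , r<a , a<b , b≤ with a <? p
  ... | yes a<p = cube∉F-large pp pa r<a (≤-pred (≤-trans a<b b≤)) a<p inF
  -- Here p ≤ a < b ≤ 2r + 1 ≤ p + r, the last because r < p.
  ... | no a≮p = cube∉F-small pp pb r<p (≤-<-trans (≮⇒≥ a≮p) a<b) (≤-trans b≤ (+-monoˡ-≤ r r<p)) inF

theorem3p2 : (r : ℕ) → 1 ≤ r → (S : ℕ → ℕ) → IsS r S →
    ((q : ℕ) → IsLeastPrimeAbove r q → ¬ InF S (q ^ 2))
    × ((p : ℕ) → Prime p → ¬ InF S (p ^ 3))
theorem3p2 r 1≤r S isS = square , cube∉F isS 1≤r
  where
  square : ∀ q → IsLeastPrimeAbove r q → ¬ InF S (q ^ 2)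
  square q (pq , r<q , least) with twoPrimes 1≤r
  -- Leastness gives q ≤ a < b, so b serves as the larger prime: any prime in (q, q + r] would do,
  -- and b ≤ 2r + 1 ≤ q + r.
  ... | a , b , pa , pb , r<a , a<b , b≤ = square∉F isS pq pb r<q
    (≤-<-trans (least a pa r<a) a<b) (≤-trans b≤ (+-monoˡ-≤ r r<q))
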